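{- Write $f(k,m,n)=f_{\text{2--1--2'}}(k,m,n)$. Then: (i) $f(2,m,n)=2^{n-m-1}$ for $1\le m\le n-4$; (ii) $f(2,n-2,n)=7$ for $n\ge4$; (iii) $f(2,n-1,n)=1$ for $n\ge4$; (iv) $f(2,m,n)=0$ for all other pairs $(m,n)$.
   Context: The standard cycle form of $\pi\in\mathcal S_n$ writes each cycle starting with its smallest element, cycles listed in decreasing order of smallest elements; $\Psi(\pi)$ is the word obtained by deleting the parentheses. A cyclic occurrence of 2--1--2' in $\pi$ is a triple of indices $i<j<k$ with $w_j<w_i$ and $w_j<w_k$, where $w=\Psi(\pi)$. $f_{\text{2--1--2'}}(k,m,n)$ is the number of $\pi\in\mathcal S_n$ with $m$ cycles and exactly $k$ cyclic occurrences of 2--1--2'. -}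

module Defs where

open import Data.Nat using (ℕ; zero; suc; _+_; _≤ᵇ_; _<ᵇ_; _≡ᵇ_)
open import Data.Bool using (Bool; true; false; if_then_else_; _∧_; not)
open import Data.Fin using (Fin; toℕ)
open import Data.Vec using (Vec; []; _∷_; lookup)
open import Data.List using (List; []; _∷_; length; filter; map; concatMap; reverse; allFin)
open import Relation.Nullary.Decidable using (yes; no)
open import Relation.Binary.PropositionalEquality using (_≡_)
open import Data.Bool using (T?)

-- A permutation of {0,…,n-1} is given in one-line notation as a vector
-- v : Vec (Fin n) n (π(i) = lookup v i) which is injective.

all : {A : Set} → (A → Bool) → List A → Bool
all p [] = true
all p (x ∷ xs) = p x ∧ all p xs

allVecs : {A : Set} → List A → (len : ℕ) → List (Vec A len)
allVecs xs zero = [] ∷ []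
allVecs xs (suc len) = concatMap (λ x → map (x ∷_) (allVecs xs len)) xs

_==_ : {n : ℕ} → Fin n → Fin n → Bool
i == j = toℕ i ≡ᵇ toℕ j

isPerm : {n : ℕ} → Vec (Fin n) n → Bool
isPerm {n} v = all (λ i → all (λ j → (i == j) ∨' not (lookup v i == lookup v j)) (allFin n)) (allFin n)
  where
  _∨'_ : Bool → Bool → Bool
  true ∨' _ = true
  false ∨' b = b

perms : (n : ℕ) → List (Vec (Fin n) n)
perms n = filter (λ v → T? (isPerm v)) (allVecs (allFin n) n)

-- the cycle of π through i, listed starting at i: i, π i, π² i, … (fuel n suffices)
cycleFrom : {n : ℕ} → Vec (Fin n) n → Fin n → List (Fin n)
cycleFrom {n} v i = i ∷ walk n (lookup v i)
  where
  walk : ℕ → Fin n → List (Fin n)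
  walk zero _ = []
  walk (suc f) j = if j == i then [] else (j ∷ walk f (lookup v j))

isCycleMin : {n : ℕ} → Vec (Fin n) n → Fin n → Bool
isCycleMin v i = all (λ j → toℕ i ≤ᵇ toℕ j) (cycleFrom v i)

numCycles : {n : ℕ} → Vec (Fin n) n → ℕ
numCycles {n} v = length (filter (λ i → T? (isCycleMin v i)) (allFin n))

-- Ψ(π): standard cycle form (each cycle starting with its smallest element,
-- cycles in decreasing order of smallest elements) with parentheses removed
Ψ : {n : ℕ} → Vec (Fin n) n → List ℕ
Ψ {n} v = map toℕ (concatMap (cycleFrom v)
            (filter (λ i → T? (isCycleMin v i)) (reverse (allFin n))))

pairsBelow : ℕ → List ℕ → ℕ
pairsBelow x [] = 0
pairsBelow x (y ∷ ys) =
  (if y <ᵇ x then length (filter (λ z → T? (y <ᵇ z)) ys) else 0) + pairsBelow x ys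

occ212 : List ℕ → ℕ
occ212 [] = 0
occ212 (x ∷ xs) = pairsBelow x xs + occ212 xs

f : ℕ → ℕ → ℕ → ℕ
f k m n = length (filter (λ v → T? ((numCycles v ≡ᵇ m) ∧ (occ212 (Ψ v) ≡ᵇ k))) (perms n))

{-# OPTIONS --safe #-}
module Submission where

open import Defs
open import Data.Bool using (Bool; true; false; if_then_else_; _∧_; T; T?)
open import Data.Bool.Properties using (T-∧; ∧-comm)
open import Data.Fin using (Fin; toℕ)
open import Data.Fin.Properties using (pigeonhole; toℕ-injective; toℕ<n)
open import Data.List using (List; []; _∷_; _++_; allFin; applyUpTo; concatMap; filter; length; map; reverse; tabulate; upTo)
open import Data.List.Membership.Propositional using (_∈_)
open import Data.List.Membership.Propositional.Properties using (∈-∃++; ∈-allFin; ∈-concat⁺′; ∈-concat⁻′; ∈-filter⁺; ∈-filter⁻; ∈-map⁺; ∈-map⁻)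
open import Data.List.Properties using (++-identityʳ; ∷-injective; ∷-injectiveʳ; concatMap-cong; filter-++; filter-all; length-++; length-map; length-tabulate; length-upTo; map-++; map-injective; map-tabulate; map-upTo; unfold-reverse)
open import Data.List.Relation.Binary.Permutation.Propositional using (_↭_; prep; swap; ↭-refl; ↭-reflexive; ↭-sym; ↭-trans; ↭⇒↭ₛ)
open import Data.List.Relation.Binary.Permutation.Propositional.Properties using (All-resp-↭; drop-∷; filter-↭; map⁺; shift; ∈-resp-↭; ↭-empty-inv; ↭-length; ↭-map-inv; ↭-reverse)
import Data.List.Relation.Binary.Permutation.Setoid.Properties as Permutationₛ
open import Data.List.Relation.Binary.Subset.Propositional using (_⊆_)
open import Data.List.Relation.Unary.All as All using (All; []; _∷_)
import Data.List.Relation.Unary.All.Properties as Allₚ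
open import Data.List.Relation.Unary.AllPairs as AllPairs using (AllPairs; []; _∷_)
import Data.List.Relation.Unary.AllPairs.Properties as AllPairsₚ
open import Data.List.Relation.Unary.Any using (here; there)
open import Data.List.Relation.Unary.Unique.Propositional using (Unique)
import Data.List.Relation.Unary.Unique.Propositional.Properties as Uniqueₚ
open import Data.Nat using (ℕ; zero; suc; _+_; _*_; _∸_; _^_; _≤_; _<_; _<ᵇ_; _≡ᵇ_; z≤n; s≤s; s≤s⁻¹; z<s)
open import Data.Nat.Properties
open import Data.Nat.Tactic.RingSolver using (solve-∀)
open import Data.Product using (_×_; _,_; ∃; ∃₂; proj₁; proj₂)
open import Data.Vec as Vec using (Vec; []; _∷_; fromList; lookup; toList)
open import Data.Vec.Membership.Propositional.Properties using (∈-lookup; ∈-toList⁺)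
import Data.Vec.Properties as Vecₚ
open import Function using (Equivalence; _∘_; const; id)
open import Relation.Binary.PropositionalEquality as ≡ using (_≡_; _≢_; cong; cong₂; module ≡-Reasoning; refl; subst; sym)
open import Relation.Nullary using (¬_; contradiction; no; yes)
open import Data.List.Extrema ≤-totalOrder using (argmin; argmin-all; f[argmin]≤f[xs])

-- The standard form of π lists its cycles by decreasing minima, so the cycle minima are exactly the left-to-right
-- minima of Ψ(π); the cycles, hence π, can be read off the word, and Ψ is injective from permutations to words.
-- Words and permutations (in one-line notation) being equinumerous, Ψ maps the permutations bijectively onto the
-- words, and numCycles becomes the number of left-to-right minima.
--
-- Build the words by inserting the letters in decreasing order. A new smallest letter with p letters to its left and
-- q to its right adds pq occurrences of 2-1-2'. From the fifth letter on, an inner position adds at least 3, so only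
-- the two ends are possible: putting the letter first leaves one left-to-right minimum, putting it last adds one.
-- This recursion starts from the eight words of length 4 having two occurrences.

private variable
  A B : Set
  n : ℕ

-- Counting the entries of a list that pass a Boolean test.

𝟙 : Bool → ℕ
𝟙 b = if b then 1 else 0

count : (A → Bool) → List A → ℕ
count p []       = 0
count p (x ∷ xs) = 𝟙 (p x) + count p xs

length-filter≡count : (p : A → Bool) (xs : List A) → length (filter (λ x → T? (p x)) xs) ≡ count p xs
length-filter≡count p [] = refl
length-filter≡count p (x ∷ xs) with p x
... | true  = cong suc (length-filter≡count p xs)
... | false = length-filter≡count p xs

count-cong : {p q : A → Bool} (xs : List A) → (∀ {x} → x ∈ xs → p x ≡ q x) → count p xs ≡ count q xs
count-cong []       p≡q = refl
count-cong (x ∷ xs) p≡q = cong₂ _+_ (cong 𝟙 (p≡q (here refl))) (count-cong xs (p≡q ∘ there))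

count-map : (p : B → Bool) (g : A → B) (xs : List A) → count p (map g xs) ≡ count (p ∘ g) xs
count-map p g []       = refl
count-map p g (x ∷ xs) = cong (𝟙 (p (g x)) +_) (count-map p g xs)

count-++ : (p : A → Bool) (xs ys : List A) → count p (xs ++ ys) ≡ count p xs + count p ys
count-++ p []       ys = refl
count-++ p (x ∷ xs) ys = ≡.trans (cong (𝟙 (p x) +_) (count-++ p xs ys)) (sym (+-assoc (𝟙 (p x)) _ _))

count-none : (p : A → Bool) {xs : List A} → All (λ x → p x ≡ false) xs → count p xs ≡ 0
count-none p []                 = refl
count-none p (px ∷ pxs) rewrite px = count-none p pxs

count-↭ : (p : A → Bool) {xs ys : List A} → xs ↭ ys → count p xs ≡ count p ys
count-↭ p {xs} {ys} xs↭ys = begin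
  count p xs                               ≡⟨ length-filter≡count p xs ⟨
  length (filter (λ x → T? (p x)) xs)      ≡⟨ ↭-length (filter-↭ (λ x → T? (p x)) xs↭ys) ⟩
  length (filter (λ x → T? (p x)) ys)      ≡⟨ length-filter≡count p ys ⟩
  count p ys                               ∎
  where
  open ≡-Reasoning

count-concatMap : (p : B → Bool) (q r : A → Bool) (h : A → List B) {xs : List A} →
  All (λ x → count p (h x) ≡ 𝟙 (q x) + 𝟙 (r x)) xs → count p (concatMap h xs) ≡ count q xs + count r xs
count-concatMap p q r h []                   = refl
count-concatMap p q r h {x ∷ xs} (eq ∷ eqs)  = begin
  count p (h x ++ concatMap h xs)                     ≡⟨ count-++ p (h x) _ ⟩
  count p (h x) + count p (concatMap h xs)            ≡⟨ cong₂ _+_ eq (count-concatMap p q r h eqs) ⟩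
  𝟙 (q x) + 𝟙 (r x) + (count q xs + count r xs)       ≡⟨ interchange (𝟙 (q x)) (𝟙 (r x)) (count q xs) (count r xs) ⟩
  𝟙 (q x) + count q xs + (𝟙 (r x) + count r xs)       ∎
  where
  open ≡-Reasoning
  interchange : ∀ a b c d → a + b + (c + d) ≡ a + c + (b + d)
  interchange = solve-∀

-- The pigeonhole principle for lists without repetitions.

∈-∷⁻-≢ : {x y : A} {xs : List A} → y ≢ x → y ∈ x ∷ xs → y ∈ xs
∈-∷⁻-≢ y≢x (here y≡x)   = contradiction y≡x y≢x
∈-∷⁻-≢ y≢x (there y∈xs) = y∈xs

-- Induction on xs: its head is cut out of ys, and its tail, which avoids the head, still lies in
-- what is left. The remainder zs measures by how much ys exceeds xs.
unique⊆⇒extends : {xs ys : List A} → Unique xs → xs ⊆ ys → ∃ λ zs → xs ++ zs ↭ ys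
unique⊆⇒extends {xs = []}     {ys} _ _ = ys , ↭-refl
unique⊆⇒extends {xs = x ∷ xs} {ys} (x∉xs ∷ uxs) xs⊆ys
  with us , vs , refl ← ∈-∃++ (xs⊆ys (here refl))
  with zs , xs++zs↭ ← unique⊆⇒extends uxs (λ y∈xs →
         ∈-∷⁻-≢ (λ y≡x → All.lookup x∉xs y∈xs (sym y≡x)) (∈-resp-↭ (shift x us vs) (xs⊆ys (there y∈xs))))
  = zs , ↭-trans (prep x xs++zs↭) (↭-sym (shift x us vs))

unique⊆⇒length≤ : {xs ys : List A} → Unique xs → xs ⊆ ys → length xs ≤ length ys
unique⊆⇒length≤ {xs = xs} u xs⊆ys with zs , p ← unique⊆⇒extends u xs⊆ys =
  ≤-trans (m≤m+n _ _) (≤-reflexive (≡.trans (sym (length-++ xs)) (↭-length p)))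

unique⊆⇒↭ : {xs ys : List A} → Unique xs → xs ⊆ ys → length ys ≤ length xs → xs ↭ ys
unique⊆⇒↭ {xs = xs} {ys} u xs⊆ys ys≤xs with unique⊆⇒extends u xs⊆ys
... | []     , p = ↭-trans (↭-reflexive (sym (++-identityʳ xs))) p
... | z ∷ zs , p = contradiction ys≤xs (<⇒≱ (begin-strict
  length xs                    <⟨ m<m+n (length xs) z<s ⟩
  length xs + length (z ∷ zs)  ≡⟨ length-++ xs ⟨
  length (xs ++ z ∷ zs)        ≡⟨ ↭-length p ⟩
  length ys                    ∎))
  where open ≤-Reasoning

-- Words generated by inserting a new smallest letter.

insertions : A → List A → List (List A)
insertions a []       = (a ∷ []) ∷ []
insertions a (x ∷ xs) = (a ∷ x ∷ xs) ∷ map (x ∷_) (insertions a xs)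

-- Raising all letters frees 0 for the new one, so that the letters enter in decreasing order.
words : ℕ → List (List ℕ)
words zero    = [] ∷ []
words (suc n) = concatMap (insertions 0 ∘ map suc) (words n)

∈-insertions⁺ : (a : A) (us vs : List A) → us ++ a ∷ vs ∈ insertions a (us ++ vs)
∈-insertions⁺ a []       []       = here refl
∈-insertions⁺ a []       (v ∷ vs) = here refl
∈-insertions⁺ a (u ∷ us) vs       = there (∈-map⁺ (u ∷_) (∈-insertions⁺ a us vs))

insertions-↭ : (a : A) (xs : List A) {w : List A} → w ∈ insertions a xs → w ↭ a ∷ xs
insertions-↭ a []       (here refl) = ↭-refl
insertions-↭ a (x ∷ xs) (here refl) = ↭-refl
insertions-↭ a (x ∷ xs) (there w∈) with w′ , w′∈ , refl ← ∈-map⁻ (x ∷_) w∈ =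
  ↭-trans (prep x (insertions-↭ a xs w′∈)) (swap x a ↭-refl)

upTo-suc : ∀ n → upTo (suc n) ≡ 0 ∷ map suc (upTo n)
upTo-suc n = cong (0 ∷_) (sym (map-upTo suc n))

-- Cutting 0 out of the word and lowering the other letters leaves a rearrangement of `upTo n`, from
-- which the word arises by one insertion.
∈-words⁺ : ∀ n {w} → w ↭ upTo n → w ∈ words n
∈-words⁺ zero    w↭ with refl ← ↭-empty-inv w↭ = here refl
∈-words⁺ (suc n) {w} w↭
  with us , vs , refl ← ∈-∃++ (∈-resp-↭ (↭-sym w↭) (here refl))
  with w′ , eq , p ← ↭-map-inv suc (drop-∷ (↭-trans (↭-reflexive (sym (upTo-suc n))) (↭-trans (↭-sym w↭) (shift 0 us vs))))
  = ∈-concat⁺′ (subst (λ l → us ++ 0 ∷ vs ∈ insertions 0 l) eq (∈-insertions⁺ 0 us vs))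
               (∈-map⁺ (insertions 0 ∘ map suc) (∈-words⁺ n (↭-sym p)))

∈-words-suc⁻ : ∀ n {w} → w ∈ words (suc n) → ∃ λ w′ → w′ ∈ words n × w ∈ insertions 0 (map suc w′)
∈-words-suc⁻ n w∈
  with ws , w∈ws , ws∈ ← ∈-concat⁻′ (map (insertions 0 ∘ map suc) (words n)) w∈
  with w′ , w′∈ , refl ← ∈-map⁻ (insertions 0 ∘ map suc) ws∈
  = w′ , w′∈ , w∈ws

∈-words⁻ : ∀ n {w} → w ∈ words n → w ↭ upTo n
∈-words⁻ zero    (here refl) = ↭-refl
∈-words⁻ (suc n) {w} w∈ with w′ , w′∈ , w∈ins ← ∈-words-suc⁻ n w∈ =
  ↭-trans (insertions-↭ 0 (map suc w′) w∈ins)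
    (↭-trans (prep 0 (map⁺ suc (∈-words⁻ n w′∈))) (↭-reflexive (sym (upTo-suc n))))

length-word : ∀ n {w} → w ∈ words n → length w ≡ n
length-word n w∈ = ≡.trans (↭-length (∈-words⁻ n w∈)) (length-upTo n)

positives : List ℕ → List ℕ
positives = filter (0 <?_)

-- A word can be recovered from each of its insertions, so different words have no insertion in
-- common; `words-unique` rests on this.
positives-insertions : ∀ {xs w} → All (0 <_) xs → w ∈ insertions 0 xs → positives w ≡ xs
positives-insertions {[]}     []       (here refl) = refl
positives-insertions {suc x ∷ xs} (px ∷ pxs) (here refl) = filter-all (0 <?_) (px ∷ pxs)
positives-insertions {suc x ∷ xs} (px ∷ pxs) (there w∈)
  with w′ , w′∈ , refl ← ∈-map⁻ (suc x ∷_) w∈ = cong (suc x ∷_) (positives-insertions pxs w′∈)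

map-suc-positive : (xs : List ℕ) → All (0 <_) (map suc xs)
map-suc-positive xs = Allₚ.map⁺ (All.universal (λ _ → z<s) xs)

insertions-unique : ∀ {a : A} {xs} → All (a ≢_) xs → Unique (insertions a xs)
insertions-unique []            = [] ∷ []
insertions-unique {a = a} {x ∷ xs} (a≢x ∷ a∉xs) =
  Allₚ.map⁺ (All.universal (λ _ eq → a≢x (proj₁ (∷-injective eq))) _)
  ∷ Uniqueₚ.map⁺ ∷-injectiveʳ (insertions-unique a∉xs)

words-unique : ∀ n → Unique (words n)
words-unique zero    = [] ∷ []
words-unique (suc n) = Uniqueₚ.concat⁺
  (Allₚ.map⁺ (All.universal (λ w → insertions-unique (All.map <⇒≢ (map-suc-positive w))) _))
  (AllPairsₚ.map⁺ (AllPairs.map (λ {u} {v} u≢v {w} (w∈u , w∈v) → u≢v (map-injective suc-injective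
      (≡.trans (sym (positives-insertions (map-suc-positive u) w∈u)) (positives-insertions (map-suc-positive v) w∈v))))
    (words-unique n)))

-- Left-to-right minima and occurrences when a smallest letter enters.

minimaBelow : ℕ → List ℕ → ℕ
minimaBelow b []       = 0
minimaBelow b (y ∷ ys) = if y <ᵇ b then suc (minimaBelow y ys) else minimaBelow b ys

-- Left-to-right minima: the bound carried by `minimaBelow` is the least letter read so far, and the
-- first letter always counts.
minima : List ℕ → ℕ
minima []       = 0
minima (x ∷ xs) = suc (minimaBelow x xs)

minimaBelow-map-suc : ∀ b xs → minimaBelow (suc b) (map suc xs) ≡ minimaBelow b xs
minimaBelow-map-suc b [] = refl
minimaBelow-map-suc b (y ∷ ys) with y <ᵇ b
... | true  = cong suc (minimaBelow-map-suc y ys)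
... | false = minimaBelow-map-suc b ys

minima-map-suc : ∀ xs → minima (map suc xs) ≡ minima xs
minima-map-suc []       = refl
minima-map-suc (x ∷ xs) = cong suc (minimaBelow-map-suc x xs)

minimaBelow-zero : ∀ xs → minimaBelow 0 xs ≡ 0
minimaBelow-zero []       = refl
minimaBelow-zero (x ∷ xs) = minimaBelow-zero xs

minimaBelow-snoc-0 : ∀ {b xs} → 0 < b → All (0 <_) xs → minimaBelow b (xs ++ 0 ∷ []) ≡ suc (minimaBelow b xs)
minimaBelow-snoc-0 {suc b} b>0 [] = refl
minimaBelow-snoc-0 {b} {y ∷ ys} b>0 (y>0 ∷ ys>0) with y <ᵇ b
... | true  = cong suc (minimaBelow-snoc-0 y>0 ys>0)
... | false = minimaBelow-snoc-0 b>0 ys>0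

minima-snoc-0 : ∀ {xs} → All (0 <_) xs → minima (xs ++ 0 ∷ []) ≡ suc (minima xs)
minima-snoc-0 []           = refl
minima-snoc-0 (x>0 ∷ xs>0) = cong suc (minimaBelow-snoc-0 x>0 xs>0)

length-filter-map-suc : ∀ y zs → length (filter (λ z → T? (suc y <ᵇ z)) (map suc zs)) ≡ length (filter (λ z → T? (y <ᵇ z)) zs)
length-filter-map-suc y zs = ≡.trans (length-filter≡count (suc y <ᵇ_) (map suc zs))
  (≡.trans (count-map (suc y <ᵇ_) suc zs) (sym (length-filter≡count (y <ᵇ_) zs)))

pairsBelow-map-suc : ∀ x ys → pairsBelow (suc x) (map suc ys) ≡ pairsBelow x ys
pairsBelow-map-suc x []       = refl
pairsBelow-map-suc x (y ∷ ys) = cong₂ _+_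
  (cong (λ k → if y <ᵇ x then k else 0) (length-filter-map-suc y ys)) (pairsBelow-map-suc x ys)

occ212-map-suc : ∀ xs → occ212 (map suc xs) ≡ occ212 xs
occ212-map-suc []       = refl
occ212-map-suc (x ∷ xs) = cong₂ _+_ (pairsBelow-map-suc x xs) (occ212-map-suc xs)

pairsBelow-zero : ∀ ys → pairsBelow 0 ys ≡ 0
pairsBelow-zero []       = refl
pairsBelow-zero (y ∷ ys) = pairsBelow-zero ys

-- In first place, 0 could only be the left letter of an occurrence, but it exceeds no letter.
occ212-cons-0 : ∀ xs → occ212 (0 ∷ xs) ≡ occ212 xs
occ212-cons-0 xs = cong (_+ occ212 xs) (pairsBelow-zero xs)

length-filter-snoc-0 : ∀ y zs → length (filter (λ z → T? (y <ᵇ z)) (zs ++ 0 ∷ [])) ≡ length (filter (λ z → T? (y <ᵇ z)) zs)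
length-filter-snoc-0 y zs = ≡.trans (cong length (filter-++ (λ z → T? (y <ᵇ z)) zs (0 ∷ [])))
  (≡.trans (length-++ (filter (λ z → T? (y <ᵇ z)) zs)) (+-identityʳ _))

pairsBelow-snoc-0 : ∀ x ys → pairsBelow x (ys ++ 0 ∷ []) ≡ pairsBelow x ys
pairsBelow-snoc-0 zero    []       = refl
pairsBelow-snoc-0 (suc x) []       = refl
pairsBelow-snoc-0 x       (y ∷ ys) = cong₂ _+_
  (cong (λ k → if y <ᵇ x then k else 0) (length-filter-snoc-0 y ys)) (pairsBelow-snoc-0 x ys)

-- In last place, 0 could only be the right letter of an occurrence, but it exceeds no letter.
occ212-snoc-0 : ∀ xs → occ212 (xs ++ 0 ∷ []) ≡ occ212 xs
occ212-snoc-0 []       = refl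
occ212-snoc-0 (x ∷ xs) = cong₂ _+_ (pairsBelow-snoc-0 x xs) (occ212-snoc-0 xs)

pairsBelow-0-≥ : ∀ {x us vs} → 0 < x → All (0 <_) vs → length vs ≤ pairsBelow x (us ++ 0 ∷ vs)
pairsBelow-0-≥ {suc x} {[]} {vs} x>0 vs>0 = begin
  length vs                                          ≡⟨ cong length (filter-all (λ z → T? (0 <ᵇ z)) (All.map <⇒<ᵇ vs>0)) ⟨
  length (filter (λ z → T? (0 <ᵇ z)) vs)             ≤⟨ m≤m+n _ _ ⟩
  pairsBelow (suc x) (0 ∷ vs)                        ∎
  where open ≤-Reasoning
pairsBelow-0-≥ {x} {u ∷ us} x>0 vs>0 = ≤-trans (pairsBelow-0-≥ {x} {us} x>0 vs>0) (m≤n+m _ _)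

-- Each letter to the left of 0 and each letter to its right form an occurrence with 0 in the
-- middle.
occ212-0-≥ : ∀ {us vs} → All (0 <_) us → All (0 <_) vs → length us * length vs ≤ occ212 (us ++ 0 ∷ vs)
occ212-0-≥ []                     vs>0 = z≤n
occ212-0-≥ {u ∷ us} (u>0 ∷ us>0) vs>0 = +-mono-≤ (pairsBelow-0-≥ {u} {us} u>0 vs>0) (occ212-0-≥ us>0 vs>0)

-- The recursion for words with two occurrences.

innerInsertions : A → A → List A → List (List A)
innerInsertions a x []       = []
innerInsertions a x (y ∷ ys) = (x ∷ a ∷ y ∷ ys) ∷ map (x ∷_) (innerInsertions a y ys)

insertions-∷ : (a x : A) (xs : List A) →
  insertions a (x ∷ xs) ≡ (a ∷ x ∷ xs) ∷ innerInsertions a x xs ++ ((x ∷ xs) ++ a ∷ []) ∷ []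
insertions-∷ a x []       = refl
insertions-∷ a x (y ∷ ys) = cong ((a ∷ x ∷ y ∷ ys) ∷_) (≡.trans (cong (map (x ∷_)) (insertions-∷ a y ys))
  (cong ((x ∷ a ∷ y ∷ ys) ∷_) (map-++ (x ∷_) (innerInsertions a y ys) _)))

innerInsertions-split : (a x : A) (xs : List A) {w : List A} → w ∈ innerInsertions a x xs →
  ∃₂ λ u us → ∃₂ λ v vs → x ∷ xs ≡ (u ∷ us) ++ v ∷ vs × w ≡ (u ∷ us) ++ a ∷ v ∷ vs
innerInsertions-split a x (y ∷ ys) (here refl) = x , [] , y , ys , refl , refl
innerInsertions-split a x (y ∷ ys) (there w∈)
  with w′ , w′∈ , refl ← ∈-map⁻ (x ∷_) w∈
  with u , us , v , vs , eq , refl ← innerInsertions-split a y ys w′∈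
  = x , u ∷ us , v , vs , cong (x ∷_) eq , refl

-- With p = m + 1 and q = n + 1, the product pq exceeds p + q - 1 by mn, and p + q - 1 is at least
-- 3.
2<1+m*1+n : ∀ m n → 4 ≤ suc m + suc n → 2 < suc m * suc n
2<1+m*1+n m n 4≤ = begin
  3                      ≤⟨ s≤s⁻¹ 4≤ ⟩
  m + suc n              ≤⟨ m≤m+n _ (m * n) ⟩
  m + suc n + m * n      ≡⟨ expand m n ⟩
  suc m * suc n          ∎
  where
  open ≤-Reasoning
  expand : ∀ m n → m + suc n + m * n ≡ suc m * suc n
  expand = solve-∀

-- Both sides of 0 are non-empty and together have at least four letters. With only three, the split
-- 1 + 2 could give exactly two occurrences; hence the recursion starts from length four.
occ212-inner : ∀ {x xs w} → All (0 <_) (x ∷ xs) → 4 ≤ length (x ∷ xs) → w ∈ innerInsertions 0 x xs → 2 < occ212 w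
occ212-inner {x} {xs} xs>0 4≤ w∈ with u , us , v , vs , eq , refl ← innerInsertions-split 0 x xs w∈ =
  ≤-trans (2<1+m*1+n (length us) (length vs) (subst (4 ≤_) (≡.trans (cong length eq) (length-++ (u ∷ us))) 4≤))
    (occ212-0-≥ (Allₚ.++⁻ˡ (u ∷ us) all>0) (Allₚ.++⁻ʳ (u ∷ us) all>0))
  where all>0 = subst (All (0 <_)) eq xs>0

-- The test q is arbitrary, rather than equality with some m, because the recursion replaces it by a
-- constant and by a shift.
twoOcc : (ℕ → Bool) → List ℕ → Bool
twoOcc q w = (occ212 w ≡ᵇ 2) ∧ q (minima w)

twoOcc-> : ∀ q {w} → 2 < occ212 w → twoOcc q w ≡ false
twoOcc-> q {w} 2<occ with occ212 w ≡ᵇ 2 in eq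
... | false = refl
... | true  = contradiction (≡ᵇ⇒≡ (occ212 w) 2 (subst T (sym eq) _)) (>⇒≢ 2<occ)

-- The first summand comes from 0 in front, where it is the only left-to-right minimum; the second
-- from 0 at the end, where it is one more.
count-insertions : ∀ q {w} → 4 ≤ length w →
  count (twoOcc q) (insertions 0 (map suc w)) ≡ 𝟙 (twoOcc (const (q 1)) w) + 𝟙 (twoOcc (q ∘ suc) w)
count-insertions q {x ∷ xs} 4≤ = begin
  count (twoOcc q) (insertions 0 w⁺)
    ≡⟨ cong (count (twoOcc q)) (insertions-∷ 0 (suc x) (map suc xs)) ⟩
  𝟙 (twoOcc q (0 ∷ w⁺)) + count (twoOcc q) (inner ++ (w⁺ ++ 0 ∷ []) ∷ [])
    ≡⟨ cong₂ _+_ first (≡.trans (count-++ (twoOcc q) inner _) (cong₂ _+_ none last)) ⟩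
  𝟙 (twoOcc (const (q 1)) (x ∷ xs)) + (𝟙 (twoOcc (q ∘ suc) (x ∷ xs)) + 0)
    ≡⟨ cong (𝟙 (twoOcc (const (q 1)) (x ∷ xs)) +_) (+-identityʳ _) ⟩
  𝟙 (twoOcc (const (q 1)) (x ∷ xs)) + 𝟙 (twoOcc (q ∘ suc) (x ∷ xs))
    ∎
  where
  open ≡-Reasoning
  w⁺ = map suc (x ∷ xs)
  inner = innerInsertions 0 (suc x) (map suc xs)
  first : 𝟙 (twoOcc q (0 ∷ w⁺)) ≡ 𝟙 (twoOcc (const (q 1)) (x ∷ xs))
  first = cong₂ (λ k l → 𝟙 ((k ≡ᵇ 2) ∧ q (suc l)))
    (≡.trans (occ212-cons-0 w⁺) (occ212-map-suc (x ∷ xs))) (minimaBelow-zero w⁺)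
  none : count (twoOcc q) inner ≡ 0
  none = count-none (twoOcc q) (All.tabulate λ w∈ → twoOcc-> q
    (occ212-inner (map-suc-positive (x ∷ xs)) (subst (4 ≤_) (sym (length-map suc (x ∷ xs))) 4≤) w∈))
  last : 𝟙 (twoOcc q (w⁺ ++ 0 ∷ [])) + 0 ≡ 𝟙 (twoOcc (q ∘ suc) (x ∷ xs)) + 0
  last = cong (_+ 0) (cong₂ (λ k l → 𝟙 ((k ≡ᵇ 2) ∧ q l))
    (≡.trans (occ212-snoc-0 w⁺) (occ212-map-suc (x ∷ xs)))
    (≡.trans (minima-snoc-0 (map-suc-positive (x ∷ xs))) (cong suc (minima-map-suc (x ∷ xs)))))

numTwoOcc : (ℕ → Bool) → ℕ → ℕ
numTwoOcc q n = count (twoOcc q) (words n)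

numTwoOcc-suc : ∀ q r → numTwoOcc q (5 + r) ≡ numTwoOcc (const (q 1)) (4 + r) + numTwoOcc (q ∘ suc) (4 + r)
numTwoOcc-suc q r = count-concatMap (twoOcc q) (twoOcc (const (q 1))) (twoOcc (q ∘ suc)) (insertions 0 ∘ map suc)
  (All.tabulate λ {w} w∈ → count-insertions q {w} (subst (4 ≤_) (sym (length-word (4 + r) w∈)) (m≤m+n 4 r)))

numTwoOcc-false : ∀ n → numTwoOcc (const false) n ≡ 0
-- `∧` reduces by its first argument, so the constant is brought there.
numTwoOcc-false n = count-none _ (All.universal (λ w → ≡.trans (∧-comm (occ212 w ≡ᵇ 2) false) refl) (words n))

-- Both ends are open to every word, so each further letter doubles the count.
numTwoOcc-true : ∀ r → numTwoOcc (const true) (4 + r) ≡ 2 ^ (3 + r)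
-- Evaluation over the 24 words of length four, of which eight qualify.
numTwoOcc-true zero    = refl
numTwoOcc-true (suc r) = begin
  numTwoOcc (const true) (5 + r)                               ≡⟨ numTwoOcc-suc (const true) r ⟩
  numTwoOcc (const true) (4 + r) + numTwoOcc (const true) (4 + r)  ≡⟨ cong₂ _+_ (numTwoOcc-true r) (numTwoOcc-true r) ⟩
  2 ^ (3 + r) + 2 ^ (3 + r)                                    ≡⟨ cong (2 ^ (3 + r) +_) (+-identityʳ _) ⟨
  2 ^ (4 + r)                                                  ∎
  where open ≡-Reasoning

-- Solving the recursion for each number of left-to-right minima.

wordCount : ℕ → ℕ → ℕ
wordCount m n = numTwoOcc (_≡ᵇ m) n

wordCount-zero : ∀ r → wordCount 0 (4 + r) ≡ 0
wordCount-zero zero    = refl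
wordCount-zero (suc r) = ≡.trans (numTwoOcc-suc (_≡ᵇ 0) r) (cong₂ _+_ (numTwoOcc-false (4 + r)) (numTwoOcc-false (4 + r)))

-- A single minimum forces 0 to the front, and any shifted word with two occurrences may follow it.
wordCount-one : ∀ r → wordCount 1 (5 + r) ≡ 2 ^ (3 + r)
wordCount-one r = ≡.trans (numTwoOcc-suc (_≡ᵇ 1) r) (≡.trans (cong₂ _+_ (numTwoOcc-true r) (wordCount-zero r)) (+-identityʳ _))

-- A word with 0 in front has only one minimum, so here 0 stands last, and removing it lowers both
-- parameters by one.
wordCount-suc : ∀ m r → wordCount (2 + m) (5 + r) ≡ wordCount (1 + m) (4 + r)
wordCount-suc m r = ≡.trans (numTwoOcc-suc (_≡ᵇ (2 + m)) r) (cong (_+ wordCount (1 + m) (4 + r)) (numTwoOcc-false (4 + r)))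

-- Removing the last letter m times leaves a word with one minimum and 5 + s letters.
wordCount-generic : ∀ m s → wordCount (1 + m) (5 + m + s) ≡ 2 ^ (3 + s)
wordCount-generic zero    s = wordCount-one s
wordCount-generic (suc m) s = ≡.trans (wordCount-suc m (1 + m + s)) (wordCount-generic m s)

wordCount-n-2 : ∀ r → wordCount (2 + r) (4 + r) ≡ 7
-- Of the eight words of length four, seven have two minima and one has three.
wordCount-n-2 zero    = refl
wordCount-n-2 (suc r) = ≡.trans (wordCount-suc (1 + r) r) (wordCount-n-2 r)

wordCount-n-1 : ∀ r → wordCount (3 + r) (4 + r) ≡ 1
wordCount-n-1 zero    = refl
wordCount-n-1 (suc r) = ≡.trans (wordCount-suc (2 + r) r) (wordCount-n-1 r)

-- The excluded pairs are stable under lowering m and r together, so the recursion descends until m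
-- is at most 1 or r is 0.
wordCount-vanishes : ∀ m r → ¬ (1 ≤ m × m ≤ r) → m ≢ 2 + r → m ≢ 3 + r → wordCount m (4 + r) ≡ 0
wordCount-vanishes 0                         r       _ _   _   = wordCount-zero r
wordCount-vanishes 1                         zero    _ _   _   = refl
wordCount-vanishes 2                         zero    _ 2≢  _   = contradiction refl 2≢
wordCount-vanishes 3                         zero    _ _   3≢  = contradiction refl 3≢
wordCount-vanishes (suc (suc (suc (suc m)))) zero    _ _   _   = refl
wordCount-vanishes 1                         (suc r) ∉ _   _   = contradiction (s≤s z≤n , s≤s z≤n) ∉
wordCount-vanishes (suc (suc m))             (suc r) ∉ ≢₂  ≢₃  = ≡.trans (wordCount-suc m r)
  (wordCount-vanishes (suc m) r (λ (_ , m≤r) → ∉ (s≤s z≤n , s≤s m≤r)) (≢₂ ∘ cong suc) (≢₃ ∘ cong suc))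

wordCount-small : ∀ m n → n < 4 → wordCount m n ≡ 0
-- Three letters allow at most one occurrence, so the test on occurrences fails before m is
-- examined.
wordCount-small m 0 _ = refl
wordCount-small m 1 _ = refl
wordCount-small m 2 _ = refl
wordCount-small m 3 _ = refl
wordCount-small m (suc (suc (suc (suc _)))) (s≤s (s≤s (s≤s (s≤s ()))))

-- Permutations as vectors in one-line notation.

all-T⁻ : (p : A → Bool) {xs : List A} → T (all p xs) → ∀ {x} → x ∈ xs → T (p x)
all-T⁻ p {y ∷ ys} t (here refl) = proj₁ (Equivalence.to T-∧ t)
all-T⁻ p {y ∷ ys} t (there x∈)  = all-T⁻ p (proj₂ (Equivalence.to (T-∧ {p y}) t)) x∈

all-T⁺ : (p : A → Bool) {xs : List A} → (∀ {x} → x ∈ xs → T (p x)) → T (all p xs)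
all-T⁺ p {[]}     h = _
all-T⁺ p {y ∷ ys} h = Equivalence.from T-∧ (h (here refl) , all-T⁺ p (h ∘ there))

==⇒≡ : {i j : Fin n} → T (i == j) → i ≡ j
==⇒≡ {i = i} {j} t = toℕ-injective (≡ᵇ⇒≡ (toℕ i) (toℕ j) t)

≡⇒== : {i j : Fin n} → i ≡ j → T (i == j)
≡⇒== {i = i} {j} eq = ≡⇒≡ᵇ (toℕ i) (toℕ j) (cong toℕ eq)

Perm : Vec (Fin n) n → Set
Perm v = ∀ i j → lookup v i ≡ lookup v j → i ≡ j

isPerm⇒Perm : (v : Vec (Fin n) n) → T (isPerm v) → Perm v
isPerm⇒Perm v t i j eq with i == j in i==j | all-T⁻ _ (all-T⁻ _ t (∈-allFin i)) (∈-allFin j)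
... | true  | _  = ==⇒≡ (subst T (sym i==j) _)
... | false | t′ with lookup v i == lookup v j in e
...   | false = contradiction (≡⇒== eq) (subst (λ b → ¬ T b) (sym e) id)

-- `_` is inferred to be the test of the pair i, j in `isPerm`, whose disjunction is local to `isPerm`.
mutual
  distinct-images : (v : Vec (Fin n) n) → Perm v → ∀ i j → T _

  Perm⇒isPerm : (v : Vec (Fin n) n) → Perm v → T (isPerm v)
  Perm⇒isPerm {n} v inj = all-T⁺ _ {allFin n} λ {i} _ → all-T⁺ _ {allFin n} λ {j} _ → distinct-images v inj i j

  distinct-images v inj i j with i == j in i==j
  ... | true = _
  ... | false with lookup v i == lookup v j in e
  ...   | false = _
  ...   | true  = subst T i==j (≡⇒== (inj i j (==⇒≡ (subst T (sym e) _))))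

∈-allVecs : ∀ {xs : List A} {m} (v : Vec A m) → (∀ i → lookup v i ∈ xs) → v ∈ allVecs xs m
∈-allVecs []      h = here refl
∈-allVecs {xs = xs} {suc m} (x ∷ v) h = ∈-concat⁺′ (∈-map⁺ (x ∷_) (∈-allVecs v (h ∘ Fin.suc)))
  (∈-map⁺ (λ y → map (y ∷_) (allVecs xs m)) (h Fin.zero))

allVecs-unique : ∀ {xs : List A} m → Unique xs → Unique (allVecs xs m)
allVecs-unique zero    u = [] ∷ []
allVecs-unique {xs = xs} (suc m) u = Uniqueₚ.concat⁺
  (Allₚ.map⁺ (All.universal (λ x → Uniqueₚ.map⁺ Vecₚ.∷-injectiveʳ (allVecs-unique m u)) xs))
  (AllPairsₚ.map⁺ (AllPairs.map disjoint u))
  where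
  disjoint : ∀ {x y} → x ≢ y → ∀ {v} → ¬ (v ∈ map (x ∷_) (allVecs xs m) × v ∈ map (y ∷_) (allVecs xs m))
  disjoint {x} {y} x≢y (v∈x , v∈y)
    with _ , _ , refl ← ∈-map⁻ (x ∷_) v∈x
    with _ , _ , refl ← ∈-map⁻ (y ∷_) v∈y = x≢y refl

perms-unique : ∀ n → Unique (perms n)
perms-unique n = Uniqueₚ.filter⁺ (λ v → T? (isPerm v)) (allVecs-unique n (Uniqueₚ.allFin⁺ n))

∈-perms⁺ : (v : Vec (Fin n) n) → Perm v → v ∈ perms n
∈-perms⁺ v inj = ∈-filter⁺ (λ v → T? (isPerm v)) (∈-allVecs v (∈-allFin ∘ lookup v)) (Perm⇒isPerm v inj)

∈-perms⁻ : {v : Vec (Fin n) n} → v ∈ perms n → Perm v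
∈-perms⁻ {n} {v} v∈ = isPerm⇒Perm v (proj₂ (∈-filter⁻ (λ v → T? (isPerm v)) {xs = allVecs (allFin n) n} v∈))

lookup-injective : ∀ {m} (v : Vec A m) → Unique (toList v) → ∀ i j → lookup v i ≡ lookup v j → i ≡ j
lookup-injective (x ∷ v) (x∉v ∷ u) Fin.zero  Fin.zero  eq = refl
lookup-injective (x ∷ v) (x∉v ∷ u) Fin.zero  (Fin.suc j) eq = contradiction eq (All.lookup x∉v (∈-toList⁺ (∈-lookup j v)))
lookup-injective (x ∷ v) (x∉v ∷ u) (Fin.suc i) Fin.zero  eq = contradiction (sym eq) (All.lookup x∉v (∈-toList⁺ (∈-lookup i v)))
lookup-injective (x ∷ v) (x∉v ∷ u) (Fin.suc i) (Fin.suc j) eq = cong Fin.suc (lookup-injective v u i j eq)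

map-toℕ-allFin : ∀ n → map toℕ (allFin n) ≡ upTo n
map-toℕ-allFin zero    = refl
map-toℕ-allFin (suc n) = cong (0 ∷_) (begin
  map toℕ (tabulate Fin.suc)   ≡⟨ map-tabulate Fin.suc toℕ ⟩
  tabulate (suc ∘ toℕ)         ≡⟨ map-tabulate toℕ suc ⟨
  map suc (tabulate toℕ)       ≡⟨ cong (map suc) (map-tabulate id toℕ) ⟨
  map suc (map toℕ (allFin n))           ≡⟨ cong (map suc) (map-toℕ-allFin n) ⟩
  map suc (upTo n)                       ≡⟨ map-upTo suc n ⟩
  applyUpTo suc n              ∎)
  where
  open ≡-Reasoning

toList-surjective : ∀ {m} (xs : List A) → length xs ≡ m → ∃ λ (v : Vec A m) → toList v ≡ xs
toList-surjective xs refl = fromList xs , Vecₚ.toList∘fromList xs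

oneLine : Vec (Fin n) n → List ℕ
oneLine v = map toℕ (toList v)

-- Each word is itself the one-line notation of a permutation. This correspondence, separate from
-- `Ψ`, shows that there are at least as many permutations as words.
words⊆oneLine : ∀ n → words n ⊆ map oneLine (perms n)
words⊆oneLine n {w} w∈
  with us , refl , p ← ↭-map-inv toℕ (↭-trans (↭-reflexive (map-toℕ-allFin n)) (↭-sym (∈-words⁻ n w∈)))
  with v , toList-v ← toList-surjective us (≡.trans (sym (↭-length p)) (length-tabulate id))
  = subst (λ xs → map toℕ xs ∈ map oneLine (perms n)) toList-v (∈-map⁺ oneLine (∈-perms⁺ v (lookup-injective v
      (subst Unique (sym toList-v) (Permutationₛ.Unique-resp-↭ (≡.setoid _) (↭⇒↭ₛ p) (Uniqueₚ.allFin⁺ n))))))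

length-words≤ : ∀ n → length (words n) ≤ length (perms n)
length-words≤ n = subst (length (words n) ≤_) (length-map oneLine (perms n))
  (unique⊆⇒length≤ (words-unique n) (words⊆oneLine n))

-- Cycles of a permutation.

orbit : Vec (Fin n) n → Fin n → ℕ → Fin n → List (Fin n)
orbit v i zero    j = []
orbit v i (suc k) j = if j == i then [] else (j ∷ orbit v i k (lookup v j))

rest : Vec (Fin n) n → Fin n → List (Fin n)
rest {n} v i = orbit v i n (lookup v i)

-- `_` stands for the local function `walk` of `cycleFrom`, which has no name here. In `cycleFrom` its fuel equals the
-- length of the vector; after one unfolding, abstracting over `suc k` separates the two, and `_` can be inferred.
mutual
  walk≡orbit : (v : Vec (Fin n) n) (i : Fin n) (k : ℕ) (j : Fin n) → _ ≡ orbit v i k j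

  cycleFrom≡ : (v : Vec (Fin n) n) (i : Fin n) → cycleFrom v i ≡ i ∷ rest v i
  cycleFrom≡ {n = suc k} v i with suc k | v | i | lookup v (lookup v i)
  ... | _ | v′ | i′ | j with lookup v′ i′ == i′
  ...   | true  = refl
  ...   | false = cong (λ l → i′ ∷ lookup v′ i′ ∷ l) (walk≡orbit v′ i′ k j)

  walk≡orbit v i zero    j = refl
  walk≡orbit v i (suc k) j with j == i
  ... | true  = refl
  ... | false = cong (j ∷_) (walk≡orbit v i k (lookup v j))

-- The fuel-free form of `orbit`: v is applied from j on until i is first met, and the elements
-- before i are listed.
data Path (v : Vec (Fin n) n) (i : Fin n) : Fin n → List (Fin n) → Set where
  stop : Path v i i []
  step : ∀ {j xs} → j ≢ i → Path v i (lookup v j) xs → Path v i j (j ∷ xs)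

iter : Vec (Fin n) n → ℕ → Fin n → Fin n
iter v zero    j = j
iter v (suc k) j = iter v k (lookup v j)

iter-comm : (v : Vec (Fin n) n) (k : ℕ) (j : Fin n) → iter v k (lookup v j) ≡ lookup v (iter v k j)
iter-comm v zero    j = refl
iter-comm v (suc k) j = iter-comm v k (lookup v j)

iter-cancel : (v : Vec (Fin n) n) → Perm v → ∀ s d {j} → iter v s j ≡ iter v (s + d) j → j ≡ iter v d j
iter-cancel v inj zero    d eq = eq
iter-cancel v inj (suc s) d {j} eq = inj _ _ (≡.trans (iter-cancel v inj s d eq) (iter-comm v d j))

-- Two of the n + 1 iterates of i after 0 to n steps coincide, and cancelling their common steps
-- shows that i itself recurs. So fuel n suffices for a whole cycle.
returns : (v : Vec (Fin n) n) → Perm v → ∀ i → ∃ λ k → k ≤ n × iter v k (lookup v i) ≡ i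
returns {n} v inj i
  with s , t , s<t , eq ← pigeonhole (n<1+n n) (λ t → iter v (toℕ t) i)
  -- The element i recurs after k + 1 steps, the first of which is the `lookup v i` of the
  -- statement.
  with k , 1+s+k≡t ← m≤n⇒∃[o]m+o≡n s<t
  = k , (begin
      k                   ≤⟨ m≤n+m k (suc (toℕ s)) ⟩
      suc (toℕ s) + k     ≡⟨ 1+s+k≡t ⟩
      toℕ t               ≤⟨ s≤s⁻¹ (toℕ<n t) ⟩
      n                   ∎)
  , sym (iter-cancel v inj (toℕ s) (suc k)
      (≡.trans eq (cong (λ l → iter v l i) (≡.trans (sym 1+s+k≡t) (sym (+-suc (toℕ s) k))))))
  where open ≤-Reasoning

orbit-path : (v : Vec (Fin n) n) {i : Fin n} (l k : ℕ) {j : Fin n} → k ≤ l → iter v k j ≡ i → Path v i j (orbit v i l j)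
orbit-path v zero    zero    _   refl = stop
orbit-path v {i} (suc l) k {j} k≤l eq with j == i in j==i
... | true  with refl ← ==⇒≡ {i = j} {i} (subst T (sym j==i) _) = stop
orbit-path v (suc l) zero {j} k≤l     refl | false = contradiction (≡⇒== {i = j} refl) (subst (λ b → ¬ T b) (sym j==i) id)
orbit-path v (suc l) (suc k) (s≤s k≤l) eq   | false = step (λ j≡i → subst T j==i (≡⇒== j≡i)) (orbit-path v l k k≤l eq)

rest-path : (v : Vec (Fin n) n) → Perm v → ∀ i → Path v i (lookup v i) (rest v i)
rest-path {n} v inj i with k , k≤n , eq ← returns v inj i = orbit-path v n k k≤n eq

module _ {v : Vec (Fin n) n} {i : Fin n} where

  path-functional : ∀ {j xs ys} → Path v i j xs → Path v i j ys → xs ≡ ys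
  path-functional stop         stop         = refl
  path-functional stop         (step j≢i _) = contradiction refl j≢i
  path-functional (step j≢i _) stop         = contradiction refl j≢i
  path-functional (step _ p)   (step _ q)   = cong (_ ∷_) (path-functional p q)

  path-suffix : ∀ {j xs y} → Path v i j xs → y ∈ xs → ∃ λ ys → Path v i y ys × length ys ≤ length xs
  path-suffix p@(step _ _) (here refl) = _ , p , ≤-refl
  path-suffix (step _ p)   (there y∈)  with ys , q , ys≤xs ← path-suffix p y∈ = ys , q , m≤n⇒m≤1+n ys≤xs

  path-avoids : ∀ {j xs} → Path v i j xs → All (_≢ i) xs
  path-avoids stop         = []
  path-avoids (step j≢i p) = j≢i ∷ path-avoids p

  -- If j came back, the path from its later place would be shorter than the path from j, although a
  -- path is determined by its start.
  path-unique : ∀ {j xs} → Path v i j xs → Unique xs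
  path-unique stop             = []
  path-unique {j} {_ ∷ xs} p@(step _ q) = All.tabulate fresh ∷ path-unique q
    where
    fresh : ∀ {y} → y ∈ xs → j ≢ y
    fresh y∈ refl with ys , r , ys≤xs ← path-suffix q y∈ =
      contradiction ys≤xs (<⇒≱ (≤-reflexive (cong length (path-functional p r))))

  path-start : ∀ {j xs} → Path v i j xs → j ∈ i ∷ xs
  path-start stop       = here refl
  path-start (step _ _) = there (here refl)

  path-closed : ∀ {j xs y} → Path v i j xs → y ∈ xs → lookup v y ∈ i ∷ xs
  path-closed (step _ p) (here refl) = skip (path-start p)
    where
    skip : ∀ {x y z : Fin n} {xs} → z ∈ x ∷ xs → z ∈ x ∷ y ∷ xs
    skip (here eq)  = here eq
    skip (there z∈) = there (there z∈)
  path-closed (step _ p) (there y∈) with path-closed p y∈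
  ... | here eq  = here eq
  ... | there z∈ = there (there z∈)

  module _ {S : Fin n → Set} (closed : ∀ {y} → S y → S (lookup v y)) where

    -- With membership in a fixed cycle for S, this and `path-all` say that a path starting in the
    -- cycle stays in it, whence symmetry and transitivity.
    path-end : ∀ {j xs} → Path v i j xs → S j → S i
    path-end stop       s = s
    path-end (step _ p) s = path-end p (closed s)

    path-all : ∀ {j xs} → Path v i j xs → S j → All S xs
    path-all stop       s = []
    path-all (step _ p) s = s ∷ path-all p (closed s)

-- The image of a listed element is its successor in xs, or i for the last one.
path-determines : {v v′ : Vec (Fin n) n} {i j j′ : Fin n} {xs : List (Fin n)} →
  Path v i j xs → Path v′ i j′ xs → j ≡ j′ × All (λ y → lookup v y ≡ lookup v′ y) xs
path-determines stop       stop       = refl , []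
path-determines (step _ p) (step _ q) with eq , eqs ← path-determines p q = refl , eq ∷ eqs

module _ (v : Vec (Fin n) n) (inj : Perm v) where

  infix 4 _∈cycle_
  _∈cycle_ : Fin n → Fin n → Set
  y ∈cycle i = y ∈ i ∷ rest v i

  cycle-closed : ∀ {i y} → y ∈cycle i → lookup v y ∈cycle i
  cycle-closed {i} (here refl) = path-start (rest-path v inj i)
  cycle-closed {i} (there y∈)  = path-closed (rest-path v inj i) y∈

  cycle-sym : ∀ {i y} → y ∈cycle i → i ∈cycle y
  cycle-sym (here refl) = here refl
  cycle-sym {i} {y} (there y∈) with _ , p , _ ← path-suffix (rest-path v inj i) y∈ =
    path-end {S = _∈cycle y} cycle-closed p (here refl)

  cycle-trans : ∀ {i y z} → z ∈cycle y → y ∈cycle i → z ∈cycle i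
  cycle-trans (here refl) y∈ = y∈
  cycle-trans {i} {y} (there z∈) y∈ =
    All.lookup (path-all {S = _∈cycle i} cycle-closed (rest-path v inj y) (cycle-closed y∈)) z∈

  cycle-unique : ∀ i → Unique (i ∷ rest v i)
  cycle-unique i = All.map (_∘ sym) (path-avoids (rest-path v inj i)) ∷ path-unique (rest-path v inj i)

  CycleMin : Fin n → Set
  CycleMin i = ∀ {y} → y ∈cycle i → toℕ i ≤ toℕ y

  isCycleMin⇒ : ∀ {i} → T (isCycleMin v i) → CycleMin i
  isCycleMin⇒ {i} t {y} y∈ = ≤ᵇ⇒≤ (toℕ i) (toℕ y) (all-T⁻ _ t (subst (y ∈_) (sym (cycleFrom≡ v i)) y∈))

  ⇒isCycleMin : ∀ {i} → CycleMin i → T (isCycleMin v i)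
  ⇒isCycleMin {i} min = all-T⁺ _ λ {y} y∈ → ≤⇒≤ᵇ (min (subst (y ∈_) (cycleFrom≡ v i) y∈))

  min-tail : ∀ {i} → CycleMin i → All (λ y → toℕ i < toℕ y) (rest v i)
  min-tail {i} min = All.tabulate λ y∈ → ≤∧≢⇒< (min (there y∈))
    λ eq → All.lookup (path-avoids (rest-path v inj i)) y∈ (sym (toℕ-injective eq))

  -- A common element merges the two cycles, so each minimum bounds the other.
  mins-disjoint : ∀ {i j y} → CycleMin i → CycleMin j → y ∈cycle i → y ∈cycle j → i ≡ j
  mins-disjoint min-i min-j y∈i y∈j = toℕ-injective (≤-antisym
    (min-i (cycle-trans (cycle-sym y∈j) y∈i)) (min-j (cycle-trans (cycle-sym y∈i) y∈j)))

  cycleMin-exists : ∀ y → ∃ λ i → CycleMin i × y ∈cycle i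
  cycleMin-exists y = i , (λ z∈ → All.lookup (f[argmin]≤f[xs] {f = toℕ} y (y ∷ rest v y)) (cycle-trans z∈ i∈)) , cycle-sym i∈
    where
    -- The first `y` is the default of `argmin`, and it lies in the cycle too.
    i = argmin toℕ y (y ∷ rest v y)
    i∈ : i ∈cycle y
    i∈ = argmin-all toℕ {P = _∈cycle y} (here refl) (All.tabulate id)

-- The standard cycle form as a word.

AllPairs-strengthen : {P : A → Set} {R : A → A → Set} {xs : List A} →
  All P xs → AllPairs R xs → AllPairs (λ x y → P x × P y × R x y) xs
AllPairs-strengthen []         []         = []
AllPairs-strengthen (px ∷ pxs) (rx ∷ rxs) =
  All.zipWith (λ (py , r) → px , py , r) (pxs , rx) ∷ AllPairs-strengthen pxs rxs

AllPairs-reverse : {R : A → A → Set} {xs : List A} → AllPairs R xs → AllPairs (λ x y → R y x) (reverse xs)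
AllPairs-reverse [] = []
AllPairs-reverse {xs = x ∷ xs} (rx ∷ rxs) = subst (AllPairs _) (sym (unfold-reverse x xs))
  (AllPairsₚ.++⁺ (AllPairs-reverse rxs) ([] ∷ []) (All.map (_∷ []) (All-resp-↭ (↭-sym (↭-reverse xs)) rx)))

Descending : List (Fin n) → Set
Descending = AllPairs (λ i j → toℕ j < toℕ i)

cycleMins : Vec (Fin n) n → List (Fin n)
cycleMins {n} v = filter (λ i → T? (isCycleMin v i)) (reverse (allFin n))

cycleMins-descending : (v : Vec (Fin n) n) → Descending (cycleMins v)
cycleMins-descending v = AllPairsₚ.filter⁺ (λ i → T? (isCycleMin v i)) (AllPairs-reverse (AllPairsₚ.tabulate⁺-< id))

numCycles≡length-cycleMins : (v : Vec (Fin n) n) → numCycles v ≡ length (cycleMins v)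
numCycles≡length-cycleMins {n} v = sym (↭-length (filter-↭ (λ i → T? (isCycleMin v i)) (↭-reverse (allFin n))))

-- S gives the part of a cycle after its head. Heads and tails are parameters so that the words of
-- two permutations can be compared.
blocks : (Fin n → List (Fin n)) → List (Fin n) → List (Fin n)
blocks S = concatMap (λ i → i ∷ S i)

Ψ≡blocks : (v : Vec (Fin n) n) → Ψ v ≡ map toℕ (blocks (rest v) (cycleMins v))
Ψ≡blocks v = cong (map toℕ) (concatMap-cong (cycleFrom≡ v) (cycleMins v))

Above : (Fin n → List (Fin n)) → Fin n → Set
Above S i = All (λ y → toℕ i < toℕ y) (S i)

StartsBelow : Fin n → List (Fin n) → Set
StartsBelow h xs = ∀ {y ys} → xs ≡ y ∷ ys → toℕ y < toℕ h

blocks-startsBelow : (S : Fin n → List (Fin n)) {h : Fin n} {is : List (Fin n)} →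
  All (λ i → toℕ i < toℕ h) is → StartsBelow h (blocks S is)
blocks-startsBelow S (i<h ∷ _) refl = i<h

-- The end of a cycle is visible in the word: its tail lies above h, and the first letter after it,
-- if any, below h.
++-cancel-below : {h : Fin n} {xs ys us vs : List (Fin n)} →
  All (λ y → toℕ h < toℕ y) xs → All (λ y → toℕ h < toℕ y) ys → StartsBelow h us → StartsBelow h vs →
  xs ++ us ≡ ys ++ vs → xs ≡ ys × us ≡ vs
++-cancel-below []         []         _  _  eq = refl , eq
++-cancel-below []         (y> ∷ _)   u< _  eq = contradiction (u< eq) (<-asym y>)
++-cancel-below (x> ∷ _)   []         _  v< eq = contradiction (v< (sym eq)) (<-asym x>)
++-cancel-below (_ ∷ xs>)  (_ ∷ ys>)  u< v< eq with refl , eq′ ← ∷-injective eq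
  with refl , us≡vs ← ++-cancel-below xs> ys> u< v< eq′ = refl , us≡vs

-- Equal words begin with equal heads; cutting off the first cycle where the letters drop below its
-- head leaves equal shorter words.
blocks-injective : (S S′ : Fin n → List (Fin n)) {is js : List (Fin n)} →
  Descending is → Descending js → All (Above S) is → All (Above S′) js →
  blocks S is ≡ blocks S′ js → All (λ i → S i ≡ S′ i) is
blocks-injective S S′ []         _          _          _           _  = []
blocks-injective S S′ (i> ∷ is>) (j> ∷ js>) (S> ∷ Ss>) (S′> ∷ S′s>) eq
  with refl , eq′ ← ∷-injective eq
  with Si≡ , eqs ← ++-cancel-below S> S′> (blocks-startsBelow S i>) (blocks-startsBelow S′ j>) eq′
  = Si≡ ∷ blocks-injective S S′ is> js> Ss> S′s> eqs

minimaBelow-skip : ∀ {b xs ys} → All (b <_) xs → minimaBelow b (xs ++ ys) ≡ minimaBelow b ys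
minimaBelow-skip []                        = refl
minimaBelow-skip {b} {x ∷ xs} (b<x ∷ b<xs) with x <ᵇ b in eq
... | false = minimaBelow-skip b<xs
... | true  = contradiction (<ᵇ⇒< x b (subst T (sym eq) _)) (<-asym b<x)

-- No letter of a tail is below its head, while each head is below the one before it; so after h
-- exactly the heads count.
minimaBelow-blocks : (S : Fin n → List (Fin n)) {h : Fin n} {is : List (Fin n)} →
  All (λ y → toℕ h < toℕ y) (S h) → Descending (h ∷ is) → All (Above S) is →
  minimaBelow (toℕ h) (map toℕ (S h ++ blocks S is)) ≡ length is
minimaBelow-blocks S {h} {is} Sh> (is<h ∷ is>) Ss> = begin
  minimaBelow (toℕ h) (map toℕ (S h ++ blocks S is))            ≡⟨ cong (minimaBelow (toℕ h)) (map-++ toℕ (S h) _) ⟩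
  minimaBelow (toℕ h) (map toℕ (S h) ++ map toℕ (blocks S is))  ≡⟨ minimaBelow-skip (Allₚ.map⁺ Sh>) ⟩
  minimaBelow (toℕ h) (map toℕ (blocks S is))                   ≡⟨ next is<h is> Ss> ⟩
  length is                                                     ∎
  where
  open ≡-Reasoning
  next : ∀ {is} → All (λ i → toℕ i < toℕ h) is → Descending is → All (Above S) is →
    minimaBelow (toℕ h) (map toℕ (blocks S is)) ≡ length is
  next [] _ _ = refl
  next {i ∷ is} (i<h ∷ _) is> (Si> ∷ Ss>) with toℕ i <ᵇ toℕ h | <⇒<ᵇ i<h
  ... | true | _ = cong suc (minimaBelow-blocks S Si> is> Ss>)

minima-blocks : (S : Fin n → List (Fin n)) {is : List (Fin n)} → Descending is → All (Above S) is →
  minima (map toℕ (blocks S is)) ≡ length is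
minima-blocks S []           _            = refl
minima-blocks S is>@(_ ∷ _)  (Si> ∷ Ss>)  = cong suc (minimaBelow-blocks S Si> is> Ss>)

-- `Ψ` as a bijection from permutations to words.

module _ (v : Vec (Fin n) n) (inj : Perm v) where

  cycleMins-min : All (CycleMin v inj) (cycleMins v)
  cycleMins-min = All.map (λ {i} → isCycleMin⇒ v inj {i}) (Allₚ.all-filter (λ i → T? (isCycleMin v i)) (reverse (allFin n)))

  cycleMins-above : All (Above (rest v)) (cycleMins v)
  cycleMins-above = All.map (λ {i} → min-tail v inj {i}) cycleMins-min

  cycleMins-cover : ∀ y → ∃ λ i → i ∈ cycleMins v × y ∈ i ∷ rest v i
  cycleMins-cover y with i , min , y∈ ← cycleMin-exists v inj y =
    i , ∈-filter⁺ (λ i → T? (isCycleMin v i)) (∈-resp-↭ (↭-sym (↭-reverse (allFin n))) (∈-allFin i)) (⇒isCycleMin v inj {i} min) , y∈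

  numCycles≡minima : numCycles v ≡ minima (Ψ v)
  numCycles≡minima = ≡.trans (numCycles≡length-cycleMins v)
    (sym (≡.trans (cong minima (Ψ≡blocks v)) (minima-blocks (rest v) (cycleMins-descending v) cycleMins-above)))

  blocks-unique : Unique (blocks (rest v) (cycleMins v))
  blocks-unique = Uniqueₚ.concat⁺ (Allₚ.map⁺ (All.universal (cycle-unique v inj) _))
    (AllPairsₚ.map⁺ (AllPairs.map disjoint (AllPairs-strengthen cycleMins-min (cycleMins-descending v))))
    where
    disjoint : ∀ {i j} → CycleMin v inj i × CycleMin v inj j × toℕ j < toℕ i → ∀ {y} → ¬ (y ∈ i ∷ rest v i × y ∈ j ∷ rest v j)
    disjoint {i} {j} (min-i , min-j , j<i) (y∈i , y∈j) =
      <⇒≢ j<i (cong toℕ (sym (mins-disjoint v inj {i} {j} min-i min-j y∈i y∈j)))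

  ∈-blocks : ∀ y → y ∈ blocks (rest v) (cycleMins v)
  ∈-blocks y with i , i∈ , y∈ ← cycleMins-cover y = ∈-concat⁺′ y∈ (∈-map⁺ (λ i → i ∷ rest v i) i∈)

  Ψ-↭ : Ψ v ↭ upTo n
  Ψ-↭ = ↭-trans (↭-reflexive (Ψ≡blocks v)) (↭-trans
    (map⁺ toℕ (unique⊆⇒↭ blocks-unique (λ {y} _ → ∈-allFin y)
      (unique⊆⇒length≤ (Uniqueₚ.allFin⁺ n) (λ {y} _ → ∈-blocks y))))
    (↭-reflexive (map-toℕ-allFin n)))

-- Equal words have the same tail after each cycle minimum of v. Every element lies in such a cycle,
-- and the listed cycle determines its image.
Ψ-injective : {v v′ : Vec (Fin n) n} → Perm v → Perm v′ → Ψ v ≡ Ψ v′ → v ≡ v′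
Ψ-injective {n} {v} {v′} inj inj′ eq = begin
  v                             ≡⟨ Vecₚ.tabulate∘lookup v ⟨
  Vec.tabulate (lookup v)       ≡⟨ Vecₚ.tabulate-cong agree ⟩
  Vec.tabulate (lookup v′)      ≡⟨ Vecₚ.tabulate∘lookup v′ ⟩
  v′                            ∎
  where
  open ≡-Reasoning
  rests-agree : All (λ i → rest v i ≡ rest v′ i) (cycleMins v)
  rests-agree = blocks-injective (rest v) (rest v′) (cycleMins-descending v) (cycleMins-descending v′)
    (cycleMins-above v inj) (cycleMins-above v′ inj′)
    (map-injective toℕ-injective (≡.trans (sym (Ψ≡blocks v)) (≡.trans eq (Ψ≡blocks v′))))
  agree : ∀ y → lookup v y ≡ lookup v′ y
  agree y with i , i∈ , y∈ ← cycleMins-cover v inj y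
    with vi≡v′i , eqs ← path-determines (rest-path v inj i)
           (subst (Path v′ i (lookup v′ i)) (sym (All.lookup rests-agree i∈)) (rest-path v′ inj′ i))
    = All.lookup (vi≡v′i ∷ eqs) y∈

-- Surjectivity comes from counting: the images are distinct words, and there are at least as many
-- permutations as words.
map-Ψ-perms : ∀ n → map Ψ (perms n) ↭ words n
map-Ψ-perms n = unique⊆⇒↭
  (AllPairsₚ.map⁺ (AllPairs.map (λ (inj , inj′ , v≢v′) eq → v≢v′ (Ψ-injective inj inj′ eq))
    (AllPairs-strengthen (All.tabulate ∈-perms⁻) (perms-unique n))))
  in-words
  (≤-trans (length-words≤ n) (≤-reflexive (sym (length-map Ψ (perms n)))))
  where
  in-words : map Ψ (perms n) ⊆ words n
  in-words w∈ with v , v∈ , refl ← ∈-map⁻ Ψ w∈ = ∈-words⁺ n (Ψ-↭ v (∈-perms⁻ v∈))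

-- Transfer of the counts to permutations.

f-2≡wordCount : ∀ m n → f 2 m n ≡ wordCount m n
f-2≡wordCount m n = begin
  f 2 m n
    ≡⟨ length-filter≡count (λ v → (numCycles v ≡ᵇ m) ∧ (occ212 (Ψ v) ≡ᵇ 2)) (perms n) ⟩
  count (λ v → (numCycles v ≡ᵇ m) ∧ (occ212 (Ψ v) ≡ᵇ 2)) (perms n)
    ≡⟨ count-cong (perms n) (λ {v} v∈ → ≡.trans
         (cong (λ c → (c ≡ᵇ m) ∧ (occ212 (Ψ v) ≡ᵇ 2)) (numCycles≡minima v (∈-perms⁻ v∈)))
         (∧-comm (minima (Ψ v) ≡ᵇ m) (occ212 (Ψ v) ≡ᵇ 2))) ⟩
  count (twoOcc (_≡ᵇ m) ∘ Ψ) (perms n)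
    ≡⟨ count-map (twoOcc (_≡ᵇ m)) Ψ (perms n) ⟨
  count (twoOcc (_≡ᵇ m)) (map Ψ (perms n))
    ≡⟨ count-↭ (twoOcc (_≡ᵇ m)) (map-Ψ-perms n) ⟩
  wordCount m n
    ∎
  where open ≡-Reasoning

mainTheorem18 : ((m n : ℕ) → 1 ≤ m → m + 4 ≤ n → f 2 m n ≡ 2 ^ (n ∸ m ∸ 1))
    × ((n : ℕ) → 4 ≤ n → f 2 (n ∸ 2) n ≡ 7)
    × ((n : ℕ) → 4 ≤ n → f 2 (n ∸ 1) n ≡ 1)
    × ((m n : ℕ) → ¬ (1 ≤ m × m + 4 ≤ n) → ¬ (4 ≤ n × m + 2 ≡ n)
    → ¬ (4 ≤ n × m + 1 ≡ n) → f 2 m n ≡ 0)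
mainTheorem18 = generic , n-2 , n-1 , others
  where
  generic : (m n : ℕ) → 1 ≤ m → m + 4 ≤ n → f 2 m n ≡ 2 ^ (n ∸ m ∸ 1)
  generic (suc m) n _ m+5≤n with s , refl ← m≤n⇒∃[o]m+o≡n m+5≤n = begin
    f 2 (suc m) (suc m + 4 + s)        ≡⟨ f-2≡wordCount (suc m) (suc m + 4 + s) ⟩
    wordCount (suc m) (suc m + 4 + s)  ≡⟨ cong (λ l → wordCount (suc m) (suc l + s)) (+-comm m 4) ⟩
    wordCount (suc m) (5 + m + s)      ≡⟨ wordCount-generic m s ⟩
    -- Here n exceeds the number of cycles by 4 + s, so the exponent is 3 + s.
    2 ^ (3 + s)                        ≡⟨ cong (λ l → 2 ^ (l ∸ 1)) (m+n∸m≡n (suc m) (4 + s)) ⟨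
    2 ^ (suc m + (4 + s) ∸ suc m ∸ 1)  ≡⟨ cong (λ l → 2 ^ (l ∸ suc m ∸ 1)) (+-assoc (suc m) 4 s) ⟨
    2 ^ (suc m + 4 + s ∸ suc m ∸ 1)    ∎
    where open ≡-Reasoning

  n-2 : (n : ℕ) → 4 ≤ n → f 2 (n ∸ 2) n ≡ 7
  n-2 n 4≤n with r , refl ← m≤n⇒∃[o]m+o≡n 4≤n = ≡.trans (f-2≡wordCount (2 + r) (4 + r)) (wordCount-n-2 r)

  n-1 : (n : ℕ) → 4 ≤ n → f 2 (n ∸ 1) n ≡ 1
  n-1 n 4≤n with r , refl ← m≤n⇒∃[o]m+o≡n 4≤n = ≡.trans (f-2≡wordCount (3 + r) (4 + r)) (wordCount-n-1 r)

  others : (m n : ℕ) → ¬ (1 ≤ m × m + 4 ≤ n) → ¬ (4 ≤ n × m + 2 ≡ n) → ¬ (4 ≤ n × m + 1 ≡ n) → f 2 m n ≡ 0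
  others m n ¬generic ¬n-2 ¬n-1 with 4 ≤? n
  ... | no  4≰n = ≡.trans (f-2≡wordCount m n) (wordCount-small m n (≰⇒> 4≰n))
  -- With n = 4 + r, the hypotheses exclude 1 ≤ m ≤ r, m = 2 + r and m = 3 + r.
  ... | yes 4≤n with r , refl ← m≤n⇒∃[o]m+o≡n 4≤n = ≡.trans (f-2≡wordCount m (4 + r)) (wordCount-vanishes m r
    (λ (1≤m , m≤r) → ¬generic (1≤m , subst (_≤ 4 + r) (+-comm 4 m) (+-monoʳ-≤ 4 m≤r)))
    (λ m≡2+r → ¬n-2 (4≤n , ≡.trans (+-comm m 2) (cong (2 +_) m≡2+r)))
    (λ m≡3+r → ¬n-1 (4≤n , ≡.trans (+-comm m 1) (cong (1 +_) m≡3+r))))
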